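{- Let $m \geq 0$, $n \geq 1$ be integers and let $c = (c^t; c^b)$ be a stable configuration on $K_{m,n}^0$. For $j \in \{1,\ldots,n\}$ define $k_j := |\{ i \in \{1,\ldots,m\} : c^t_i < j\}|$, and let $(\tilde{c}^b_1, \ldots, \tilde{c}^b_n)$ be the non-decreasing rearrangement of $c^b$. Then $c$ is deterministically recurrent if and only if $\tilde{c}^b_j \geq k_j$ for all $j \in \{1, \ldots, n\}$.
   Context: $K_{m,n}^0$ is the complete bipartite graph with "top" vertices $v^t_0, v^t_1, \ldots, v^t_m$ and "bottom" vertices $v^b_1, \ldots, v^b_n$, with an edge between every top vertex and every bottom vertex; $v^t_0$ is the sink. A configuration is a vector $c = (c^t_1, \ldots, c^t_m; c^b_1, \ldots, c^b_n)$ of non-negative integers ($c^*_i$ = number of grains at $v^*_i$). $c$ is stable if $c^t_i < n$ for all $i$ and $c^b_j < m+1$ for all $j$ (number of grains less than the degree). Abelian sandpile model (ASM): an unstable non-sink vertex topples by sending one grain to each of its neighbours (for bottom vertices this includes the sink); grains sent to the sink disappear. Repeated toppling from any configuration reaches a unique stable configuration independent of toppling order. In the Markov chain on stable configurations which at each step adds a grain to a uniformly random non-sink vertex and then stabilises by the ASM, a stable configuration is deterministically recurrent if it is a recurrent state (appears infinitely often). -}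

module Defs where

open import Data.Fin.Base as Fin using (Fin; zero; suc; toℕ)
import Data.Fin.Properties as Fin
import Data.Integer.Base as ℤ
open import Data.List.Base as List using (List; allFin; cartesianProductWith; filter; length)
open import Data.Nat.Base
open import Data.Nat.Induction using (<-wellFounded)
open import Data.Nat.Properties
open import Data.Nat.Tactic.RingSolver using (solve-∀)
open import Data.Product.Base using (_×_; _,_; ∃-syntax; proj₁)
open import Data.Product.Properties using (≡-dec)
open import Data.Rational.Unnormalised.Base as ℚᵘ using (ℚᵘ; 0ℚᵘ; 1ℚᵘ)
open import Data.Sum.Base using (_⊎_; inj₁; inj₂)
open import Data.Vec.Base as Vec using (Vec; []; _∷_; count; drop; lookup; map; sum; updateAt)
import Data.Vec.Functional as Functional
import Data.Vec.Functional.Relation.Binary.Permutation as Functional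
import Data.Vec.Properties as Vec
open import Data.Vec.Relation.Unary.Any as Any using (Any)
open import Induction.WellFounded using (Acc; acc)
open import Relation.Binary.Construct.Closure.ReflexiveTransitive using (Star; ε; _◅_)
open import Relation.Binary.Definitions using (DecidableEquality)
open import Relation.Binary.PropositionalEquality
open import Relation.Nullary.Decidable using (yes; no)
open import Relation.Unary using (Decidable)

-- Non-sink vertices of K⁰_{m,n}: inj₁ i is a top vertex, inj₂ j a bottom
-- vertex.  The sink is one further top vertex.  Indices run from 0, so
-- i : Fin m (resp. j : Fin n) stands for the vertex numbered suc (toℕ i)
-- (resp. suc (toℕ j)) on its side.
Vertex : ℕ → ℕ → Set
Vertex m n = Fin m ⊎ Fin n

Config : ℕ → ℕ → Set
Config m n = Vec ℕ m × Vec ℕ n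

infix 4 _≟ᶜ_
_≟ᶜ_ : ∀ {m n} → DecidableEquality (Config m n)
_≟ᶜ_ = ≡-dec (Vec.≡-dec _≟_) (Vec.≡-dec _≟_)

-- The degree of a bottom vertex counts its edge to the sink.
degree : ∀ {m n} → Vertex m n → ℕ
degree {n = n} (inj₁ _) = n
degree {m = m} (inj₂ _) = suc m

grains : ∀ {m n} → Config m n → Vertex m n → ℕ
grains (cᵗ , cᵇ) (inj₁ i) = lookup cᵗ i
grains (cᵗ , cᵇ) (inj₂ j) = lookup cᵇ j

Stable : ∀ {m n} → Config m n → Set
Stable c = ∀ v → grains c v < degree v

addGrain : ∀ {m n} → Vertex m n → Config m n → Config m n
addGrain (inj₁ i) (cᵗ , cᵇ) = updateAt cᵗ i suc , cᵇ
addGrain (inj₂ j) (cᵗ , cᵇ) = cᵗ , updateAt cᵇ j suc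

-- The neighbours of a vertex are all the vertices of the other side.  This is
-- only used at vertices with at least degree-many grains, so the truncated
-- subtraction is exact.
topple : ∀ {m n} → Vertex m n → Config m n → Config m n
topple {n = n} (inj₁ i) (cᵗ , cᵇ) = updateAt cᵗ i (_∸ n) , map suc cᵇ
topple {m = m} (inj₂ j) (cᵗ , cᵇ) = map suc cᵗ , updateAt cᵇ j (_∸ suc m)

infix 4 _⟶_ _⟶*_

data _⟶_ {m n} (c : Config m n) : Config m n → Set where
  toppling : ∀ v → degree v ≤ grains c v → c ⟶ topple v c

_⟶*_ : ∀ {m n} → Config m n → Config m n → Set
_⟶*_ = Star _⟶_

Stabilisation : ∀ {m n} → Config m n → Set
Stabilisation c = ∃[ c′ ] (c ⟶* c′ × Stable c′)

-- Every toppling strictly decreases the potential: a top toppling by n, a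
-- bottom one by m + 1.
potential : ∀ {m n} → Config m n → ℕ
potential {m} (cᵗ , cᵇ) = (2 + 2 * m) * sum cᵗ + (1 + 2 * m) * sum cᵇ

private

  sum-map-suc : ∀ {k} (xs : Vec ℕ k) → sum (map suc xs) ≡ k + sum xs
  sum-map-suc [] = refl
  sum-map-suc {suc k} (x ∷ xs) = cong suc (begin
    x + sum (map suc xs)  ≡⟨ cong (x +_) (sum-map-suc xs) ⟩
    x + (k + sum xs)      ≡⟨ lemma x k (sum xs) ⟩
    k + (x + sum xs)      ∎)
    where
    open ≡-Reasoning
    lemma : ∀ x k s → x + (k + s) ≡ k + (x + s)
    lemma = solve-∀

  sum-updateAt-∸ : ∀ {k} (xs : Vec ℕ k) i d → d ≤ lookup xs i →
                   sum xs ≡ d + sum (updateAt xs i (_∸ d))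
  sum-updateAt-∸ (x ∷ xs) zero d d≤x = begin
    x + sum xs              ≡⟨ cong (_+ sum xs) (m+[n∸m]≡n d≤x) ⟨
    d + (x ∸ d) + sum xs    ≡⟨ +-assoc d (x ∸ d) (sum xs) ⟩
    d + ((x ∸ d) + sum xs)  ∎
    where open ≡-Reasoning
  sum-updateAt-∸ (x ∷ xs) (suc i) d d≤xᵢ = begin
    x + sum xs                              ≡⟨ cong (x +_) (sum-updateAt-∸ xs i d d≤xᵢ) ⟩
    x + (d + sum (updateAt xs i (_∸ d)))    ≡⟨ lemma x d _ ⟩
    d + (x + sum (updateAt xs i (_∸ d)))    ∎
    where
    open ≡-Reasoning
    lemma : ∀ x d s → x + (d + s) ≡ d + (x + s)
    lemma = solve-∀

potential-topple : ∀ {m n} (c : Config m n) v → degree v ≤ grains c v →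
                   potential c ≡ degree v + potential (topple v c)
potential-topple {m} {n} (cᵗ , cᵇ) (inj₁ i) unstable
  rewrite sum-updateAt-∸ cᵗ i n unstable | sum-map-suc cᵇ =
    lemma m n (sum (updateAt cᵗ i (_∸ n))) (sum cᵇ)
  where
  lemma : ∀ m n s t → (2 + 2 * m) * (n + s) + (1 + 2 * m) * t
                    ≡ n + ((2 + 2 * m) * s + (1 + 2 * m) * (n + t))
  lemma = solve-∀
potential-topple {m} {n} (cᵗ , cᵇ) (inj₂ j) unstable
  rewrite sum-updateAt-∸ cᵇ j (suc m) unstable | sum-map-suc cᵗ =
    lemma m (sum cᵗ) (sum (updateAt cᵇ j (_∸ suc m)))
  where
  lemma : ∀ m s t → (2 + 2 * m) * s + (1 + 2 * m) * ((1 + m) + t)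
                  ≡ (1 + m) + ((2 + 2 * m) * (m + s) + (1 + 2 * m) * t)
  lemma = solve-∀

degree>0 : ∀ {m n} .{{_ : NonZero n}} (v : Vertex m n) → 0 < degree v
degree>0 {n = n} (inj₁ _) = >-nonZero⁻¹ n
degree>0         (inj₂ _) = z<s

topple-< : ∀ {m n} .{{_ : NonZero n}} (c : Config m n) v → degree v ≤ grains c v →
           potential (topple v c) < potential c
topple-< c v unstable =
  subst (potential (topple v c) <_) (sym (potential-topple c v unstable))
        (m<n+m _ (degree>0 v))

unstable⊎stable : ∀ {m n} (c : Config m n) →
                  (∃[ v ] degree v ≤ grains c v) ⊎ Stable c
unstable⊎stable {m} {n} (cᵗ , cᵇ)
  with Fin.any? (λ i → n ≤? lookup cᵗ i) | Fin.any? (λ j → suc m ≤? lookup cᵇ j)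
... | yes (i , p) | _           = inj₁ (inj₁ i , p)
... | no _        | yes (j , p) = inj₁ (inj₂ j , p)
... | no ¬p       | no ¬q       = inj₂ λ where
  (inj₁ i) → ≰⇒> λ p → ¬p (i , p)
  (inj₂ j) → ≰⇒> λ q → ¬q (j , q)

stabilisation : ∀ {m n} .{{_ : NonZero n}} (c : Config m n) → Stabilisation c
stabilisation {m} {n} c = go c (<-wellFounded (potential c))
  where
  go : (c : Config m n) → Acc _<_ (potential c) → Stabilisation c
  go c (acc rs) with unstable⊎stable c
  ... | inj₂ stable = c , ε , stable
  ... | inj₁ (v , unstable)
      with c′ , c⟶*c′ , stable ← go (topple v c) (rs (topple-< c v unstable))
      = c′ , toppling v unstable ◅ c⟶*c′ , stable

stabilise : ∀ {m n} .{{_ : NonZero n}} → Config m n → Config m n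
stabilise c = proj₁ (stabilisation c)

step : ∀ {m n} .{{_ : NonZero n}} → Config m n → Vertex m n → Config m n
step c v = stabilise (addGrain v c)

-- The states X₁, …, X_L of the chain started at X₀ = c, when the vertices drawn
-- are v₁, …, v_L.
trajectory : ∀ {m n L} .{{_ : NonZero n}} →
             Config m n → Vec (Vertex m n) L → Vec (Config m n) L
trajectory c []       = []
trajectory c (v ∷ vs) = step c v ∷ trajectory (step c v) vs

vertices : ∀ m n → List (Vertex m n)
vertices m n = List.map inj₁ (allFin m) List.++ List.map inj₂ (allFin n)

draws : ∀ m n L → List (Vec (Vertex m n) L)
draws m n zero    = [] List.∷ List.[]
draws m n (suc L) = cartesianProductWith _∷_ (vertices m n) (draws m n L)

-- Probability of an event that depends on L independent uniformly random
-- vertices.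
Pr : ∀ {m n L} .{{_ : NonZero n}} {E : Vec (Vertex m n) L → Set} → Decidable E → ℚᵘ
Pr {m} {n} {L} E? =
  ℚᵘ._/_ (ℤ.+ length (filter E? (draws m n L))) ((m + n) ^ L)
         {{m^n≢0 (m + n) L {{>-nonZero (m≤n⇒m≤o+n m (>-nonZero⁻¹ n))}}}}

-- Starting from c, the chain is again in state c at some time t with
-- T < t ≤ T + N.
Visits : ∀ {m n} .{{_ : NonZero n}} → Config m n →
         (T : ℕ) {N : ℕ} → Vec (Vertex m n) (T + N) → Set
Visits c T vs = Any (_≡ c) (drop T (trajectory c vs))

visits? : ∀ {m n} .{{_ : NonZero n}} (c : Config m n) T {N} →
          Decidable (Visits c T {N})
visits? c T vs = Any.any? (_≟ᶜ c) (drop T (trajectory c vs))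

-- c is a recurrent state: almost surely, the chain started at c is in state c
-- at infinitely many times.  As a countable intersection of events, this means
-- that for every T the chain almost surely visits c after time T, i.e. that the
-- probability of a visit during (T , T + N] tends to 1 as N grows; that
-- probability is non-decreasing in N, so one N for each precision δ is enough.
DeterministicallyRecurrent : ∀ {m n} .{{_ : NonZero n}} → Config m n → Set
DeterministicallyRecurrent c =
  ∀ T (δ : ℚᵘ) → 0ℚᵘ ℚᵘ.< δ → ∃[ N ] (1ℚᵘ ℚᵘ.- δ ℚᵘ.≤ Pr (visits? c T {N}))

-- k cᵗ j is k_{j+1}, with j counted from 0.
k : ∀ {m n} → Vec ℕ m → Fin n → ℕ
k cᵗ j = count (_<? suc (toℕ j)) cᵗ

record IsNonDecreasingRearrangement {n} (x̃ : Functional.Vector ℕ n) (x : Vec ℕ n) : Set where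
  field
    rearrangement : x̃ Functional.↭ lookup x
    nonDecreasing : ∀ {i j} → i Fin.≤ j → x̃ i ≤ x̃ j

{-# OPTIONS --safe #-}

-- Call c forbidden if, for some a and b > 0, at least a of its top vertices hold fewer than b
-- grains while at least b of its bottom vertices hold fewer than a.  With the bottom grains
-- sorted, it is enough to look at the pairs (k_b , b), so that not being forbidden is the
-- condition of the theorem.
--
-- Adding grains and toppling never create a forbidden configuration, and from any stable c the
-- chain reaches, with positive probability, a state that is not forbidden; so a forbidden c is
-- not recurrent.
--
-- Conversely, let c be stable and not forbidden.  By the burning algorithm, toppling the sink
-- in c and stabilising leads back to c.  Doing this often enough gives a configuration d that
-- lies above every stable one and stabilises to c.  By the abelian property every state leads
-- to c within a fixed number L of steps, so among the K^L sequences of L vertices, K = m + n,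
-- at most K^L - 1 miss c; hence at most (K^L - 1)^r of the sequences of length r L do.
module Submission where

open import Defs
import Algebra.Properties.CommutativeMonoid.Sum as CommutativeMonoidSum
open import Data.Bool.Base using (true; false; if_then_else_)
import Data.Bool.Properties as Bool
open import Data.Fin.Base as Fin using (Fin; zero; suc; toℕ)
open import Data.Fin.Permutation using (_⟨$⟩ʳ_)
import Data.Fin.Properties as Fin
open import Data.Fin.Subset using (Subset; ∣_∣; inside; outside; ⊥)
open import Data.Fin.Subset.Properties using (∣⊥∣≡0; ∣p∣≤n; ∣p∣≡n⇒p≡⊤)
import Data.Integer.Base as ℤ
import Data.Integer.Properties as ℤ
import Data.Integer.Tactic.RingSolver as ℤ
open import Data.List.Base as List using (List; cartesianProductWith; filter; length)
open import Data.List.Membership.Propositional using (_∈_)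
open import Data.List.Membership.Propositional.Properties using (∈-allFin; ∈-map⁺; ∈-++⁺ˡ; ∈-++⁺ʳ)
open import Data.List.Properties as List
  using (filter-++; filter-all; filter-≐; length-++; length-map; length-tabulate)
import Data.List.Relation.Unary.All as All
import Data.List.Relation.Unary.Any as ListAny
open import Data.Nat.Base
open import Data.Nat.Induction using (<-wellFounded)
open import Data.Nat.ListAction using () renaming (sum to sumˡ)
open import Data.Nat.Properties
open import Data.Nat.Tactic.RingSolver using (solve-∀)
open import Data.Product.Base using (_×_; _,_; ∃-syntax; proj₁; proj₂)
open import Data.Rational.Unnormalised.Base as ℚᵘ using (mkℚᵘ; 1ℚᵘ; *≤*; *<*)
open import Data.Sum.Base using (_⊎_; inj₁; inj₂)
open import Data.Sum.Properties using (≡-dec)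
open import Data.Vec.Base
  using (Vec; []; _∷_; _[_]≔_; count; drop; lookup; map; sum; tabulate; updateAt)
open import Data.Vec.Functional using (Vector)
open import Data.Vec.Functional.Relation.Binary.Permutation using (_↭_)
open import Data.Vec.Properties using
  (count≤n; lookup-map; lookup-replicate; lookup∘tabulate; lookup∘updateAt; lookup∘updateAt′;
   map-updateAt; tabulate-cong; tabulate∘lookup; updateAt-commutes; updateAt-cong-local;
   updateAt-updateAt)
open import Data.Vec.Relation.Unary.Any as Any using (Any; here; there)
open import Function.Base using (_∘_; const; id)
open import Function.Bundles using (_⇔_; mk⇔; Equivalence)
open import Induction.WellFounded using (Acc; acc)
open import Relation.Binary.Construct.Closure.ReflexiveTransitive using (ε; _◅_; _◅◅_; gmap)
open import Relation.Binary.Definitions using (DecidableEquality)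
open import Relation.Binary.PropositionalEquality
open import Relation.Nullary.Decidable using (Dec; yes; no; does; dec-true; dec-false; _×-dec_)
open import Relation.Nullary.Negation using (¬_; contradiction)
open import Relation.Unary using (Decidable; _≐_)

-- Stabilisation

infix 4 _≤ᶜ_ _≟ᵛ_

_≟ᵛ_ : ∀ {m n} → DecidableEquality (Vertex m n)
_≟ᵛ_ = ≡-dec Fin._≟_ Fin._≟_

_≤ᶜ_ : ∀ {m n} → Config m n → Config m n → Set
c ≤ᶜ d = ∀ v → grains c v ≤ grains d v

lookup-injective : ∀ {a} {A : Set a} {k} (xs ys : Vec A k) →
                   (∀ i → lookup xs i ≡ lookup ys i) → xs ≡ ys
lookup-injective xs ys eq = begin
  xs                    ≡⟨ tabulate∘lookup xs ⟨
  tabulate (lookup xs)  ≡⟨ tabulate-cong eq ⟩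
  tabulate (lookup ys)  ≡⟨ tabulate∘lookup ys ⟩
  ys                    ∎
  where open ≡-Reasoning

grains-injective : ∀ {m n} (c d : Config m n) → (∀ v → grains c v ≡ grains d v) → c ≡ d
grains-injective (cᵗ , cᵇ) (dᵗ , dᵇ) eq =
  cong₂ _,_ (lookup-injective cᵗ dᵗ (eq ∘ inj₁)) (lookup-injective cᵇ dᵇ (eq ∘ inj₂))

lookup-updateAt-suc : ∀ {k} (xs : Vec ℕ k) i j → lookup xs i ≤ lookup (updateAt xs j suc) i
lookup-updateAt-suc (x ∷ xs) zero    zero    = n≤1+n x
lookup-updateAt-suc (x ∷ xs) zero    (suc j) = ≤-refl
lookup-updateAt-suc (x ∷ xs) (suc i) zero    = ≤-refl
lookup-updateAt-suc (x ∷ xs) (suc i) (suc j) = lookup-updateAt-suc xs i j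

lookup-map-suc : ∀ {k} (xs : Vec ℕ k) i → lookup xs i ≤ lookup (map suc xs) i
lookup-map-suc xs i = subst (lookup xs i ≤_) (sym (lookup-map i suc xs)) (n≤1+n _)

c≤addGrain : ∀ {m n} v (c : Config m n) → c ≤ᶜ addGrain v c
c≤addGrain (inj₁ j) (cᵗ , cᵇ) (inj₁ i) = lookup-updateAt-suc cᵗ i j
c≤addGrain (inj₁ j) (cᵗ , cᵇ) (inj₂ i) = ≤-refl
c≤addGrain (inj₂ j) (cᵗ , cᵇ) (inj₁ i) = ≤-refl
c≤addGrain (inj₂ j) (cᵗ , cᵇ) (inj₂ i) = lookup-updateAt-suc cᵇ i j

grains-addGrain : ∀ {m n} v (c : Config m n) → grains (addGrain v c) v ≡ suc (grains c v)
grains-addGrain (inj₁ i) (cᵗ , cᵇ) = lookup∘updateAt i cᵗ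
grains-addGrain (inj₂ j) (cᵗ , cᵇ) = lookup∘updateAt j cᵇ

grains-addGrain′ : ∀ {m n} u v (c : Config m n) → u ≢ v → grains (addGrain v c) u ≡ grains c u
grains-addGrain′ (inj₁ i) (inj₁ j) (cᵗ , cᵇ) u≢v = lookup∘updateAt′ i j (u≢v ∘ cong inj₁) cᵗ
grains-addGrain′ (inj₁ i) (inj₂ j) c         u≢v = refl
grains-addGrain′ (inj₂ i) (inj₁ j) c         u≢v = refl
grains-addGrain′ (inj₂ i) (inj₂ j) (cᵗ , cᵇ) u≢v = lookup∘updateAt′ i j (u≢v ∘ cong inj₂) cᵇ

grains-topple : ∀ {m n} u v (c : Config m n) → u ≢ v → grains c u ≤ grains (topple v c) u
grains-topple (inj₁ i) (inj₁ j) (cᵗ , cᵇ) u≢v =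
  ≤-reflexive (sym (lookup∘updateAt′ i j (u≢v ∘ cong inj₁) cᵗ))
grains-topple (inj₁ i) (inj₂ j) (cᵗ , cᵇ) u≢v = lookup-map-suc cᵗ i
grains-topple (inj₂ i) (inj₁ j) (cᵗ , cᵇ) u≢v = lookup-map-suc cᵇ i
grains-topple (inj₂ i) (inj₂ j) (cᵗ , cᵇ) u≢v =
  ≤-reflexive (sym (lookup∘updateAt′ i j (u≢v ∘ cong inj₂) cᵇ))

map-suc-updateAt-∸ : ∀ {k} (xs : Vec ℕ k) i d → d ≤ lookup xs i →
                     map suc (updateAt xs i (_∸ d)) ≡ updateAt (map suc xs) i (_∸ d)
map-suc-updateAt-∸ xs i d d≤xᵢ = map-updateAt xs i (sym (+-∸-assoc 1 d≤xᵢ))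

-- On opposite sides one toppling adds a grain where the other subtracts; instability makes the
-- truncated subtraction commute with `suc`.
topple-comm : ∀ {m n} u v (c : Config m n) → u ≢ v →
              degree u ≤ grains c u → degree v ≤ grains c v →
              topple u (topple v c) ≡ topple v (topple u c)
topple-comm (inj₁ i) (inj₁ j) (cᵗ , cᵇ) u≢v p q =
  cong (_, _) (updateAt-commutes i j (u≢v ∘ cong inj₁) cᵗ)
topple-comm (inj₁ i) (inj₂ j) (cᵗ , cᵇ) u≢v p q =
  cong₂ _,_ (sym (map-suc-updateAt-∸ cᵗ i _ p)) (map-suc-updateAt-∸ cᵇ j _ q)
topple-comm (inj₂ i) (inj₁ j) (cᵗ , cᵇ) u≢v p q =
  cong₂ _,_ (map-suc-updateAt-∸ cᵗ j _ q) (sym (map-suc-updateAt-∸ cᵇ i _ p))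
topple-comm (inj₂ i) (inj₂ j) (cᵗ , cᵇ) u≢v p q =
  cong (_ ,_) (updateAt-commutes i j (u≢v ∘ cong inj₂) cᵇ)

-- Toppling one vertex takes grains from no other, so a second unstable vertex stays unstable and
-- the two topplings commute.
diamond : ∀ {m n} {c d e : Config m n} → c ⟶ d → c ⟶ e →
          d ≡ e ⊎ (∃[ f ] (d ⟶ f × e ⟶ f))
diamond {c = c} (toppling u p) (toppling v q) with u ≟ᵛ v
... | yes refl = inj₁ refl
... | no u≢v   = inj₂
  ( topple v (topple u c)
  , toppling v (≤-trans q (grains-topple v u c (u≢v ∘ sym)))
  , subst (topple v c ⟶_) (topple-comm u v c u≢v p q)
          (toppling u (≤-trans p (grains-topple u v c u≢v))) )

stable⇒¬⟶ : ∀ {m n} {c d : Config m n} → Stable c → ¬ (c ⟶ d)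
stable⇒¬⟶ stable (toppling v p) = <⇒≱ (stable v) p

-- The step `c ⟶ d` is pushed along `c ⟶* s` through squares of `diamond`. The two must meet before
-- the end, because a stable `s` allows no further step.
strip : ∀ {m n} {c d s : Config m n} → Stable s → c ⟶* s → c ⟶ d → d ⟶* s
strip stable ε            c⟶d = contradiction c⟶d (stable⇒¬⟶ stable)
strip stable (c⟶e ◅ e⟶*s) c⟶d with diamond c⟶d c⟶e
... | inj₁ refl            = e⟶*s
... | inj₂ (f , d⟶f , e⟶f) = d⟶f ◅ strip stable e⟶*s e⟶f

strip* : ∀ {m n} {c d s : Config m n} → Stable s → c ⟶* s → c ⟶* d → d ⟶* s
strip* stable c⟶*s ε              = c⟶*s
strip* stable c⟶*s (c⟶e ◅ e⟶*d) = strip* stable (strip stable c⟶*s c⟶e) e⟶*d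

⟶*-stable : ∀ {m n} {c d : Config m n} → Stable c → c ⟶* d → c ≡ d
⟶*-stable stable ε         = refl
⟶*-stable stable (c⟶d ◅ _) = contradiction c⟶d (stable⇒¬⟶ stable)

⟶*-stabilise : ∀ {m n} .{{_ : NonZero n}} (c : Config m n) → c ⟶* stabilise c
⟶*-stabilise c = proj₁ (proj₂ (stabilisation c))

stabilise-stable : ∀ {m n} .{{_ : NonZero n}} (c : Config m n) → Stable (stabilise c)
stabilise-stable c = proj₂ (proj₂ (stabilisation c))

stabilise-unique : ∀ {m n} .{{_ : NonZero n}} {c s : Config m n} →
                   c ⟶* s → Stable s → stabilise c ≡ s
stabilise-unique {c = c} c⟶*s stable =
  sym (⟶*-stable stable (strip* (stabilise-stable c) (⟶*-stabilise c) c⟶*s))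

updateAt-suc-∸ : ∀ {k} (xs : Vec ℕ k) i j d → d ≤ lookup xs i →
                 updateAt (updateAt xs j suc) i (_∸ d) ≡ updateAt (updateAt xs i (_∸ d)) j suc
updateAt-suc-∸ xs i j d d≤xᵢ with i Fin.≟ j
... | no i≢j   = updateAt-commutes i j i≢j xs
... | yes refl = begin
  updateAt (updateAt xs i suc) i (_∸ d)  ≡⟨ updateAt-updateAt i xs ⟩
  updateAt xs i (λ x → suc x ∸ d)        ≡⟨ updateAt-cong-local i xs (+-∸-assoc 1 d≤xᵢ) ⟩
  updateAt xs i (λ x → suc (x ∸ d))      ≡⟨ updateAt-updateAt i xs ⟨
  updateAt (updateAt xs i (_∸ d)) i suc  ∎
  where open ≡-Reasoning

topple-addGrain : ∀ {m n} u v (c : Config m n) → degree u ≤ grains c u →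
                  topple u (addGrain v c) ≡ addGrain v (topple u c)
topple-addGrain (inj₁ i) (inj₁ j) (cᵗ , cᵇ) p = cong (_, _) (updateAt-suc-∸ cᵗ i j _ p)
topple-addGrain (inj₁ i) (inj₂ j) (cᵗ , cᵇ) p = cong (_ ,_) (map-updateAt cᵇ j refl)
topple-addGrain (inj₂ i) (inj₁ j) (cᵗ , cᵇ) p = cong (_, _) (map-updateAt cᵗ j refl)
topple-addGrain (inj₂ i) (inj₂ j) (cᵗ , cᵇ) p = cong (_ ,_) (updateAt-suc-∸ cᵇ i j _ p)

⟶-addGrain : ∀ {m n} v {c d : Config m n} → c ⟶ d → addGrain v c ⟶ addGrain v d
⟶-addGrain v {c} (toppling u p) =
  subst (addGrain v c ⟶_) (topple-addGrain u v c p)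
        (toppling u (≤-trans p (c≤addGrain v c u)))

-- Topplings stay legal when a grain is added, so by uniqueness the grain may come before or after
-- stabilising.
step-stabilise : ∀ {m n} .{{_ : NonZero n}} (c : Config m n) v →
                 step (stabilise c) v ≡ stabilise (addGrain v c)
step-stabilise c v =
  sym (stabilise-unique
    (gmap (addGrain v) (⟶-addGrain v) (⟶*-stabilise c) ◅◅ ⟶*-stabilise _)
    (stabilise-stable _))

-- Reachability in the chain

size : ∀ {m n} → Config m n → ℕ
size (cᵗ , cᵇ) = sum cᵗ + sum cᵇ

sum-mono : ∀ {k} (xs ys : Vec ℕ k) → (∀ i → lookup xs i ≤ lookup ys i) → sum xs ≤ sum ys
sum-mono []       []       xs≤ys = z≤n
sum-mono (x ∷ xs) (y ∷ ys) xs≤ys = +-mono-≤ (xs≤ys zero) (sum-mono xs ys (xs≤ys ∘ suc))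

size-mono : ∀ {m n} (c d : Config m n) → c ≤ᶜ d → size c ≤ size d
size-mono (cᵗ , cᵇ) (dᵗ , dᵇ) c≤d =
  +-mono-≤ (sum-mono cᵗ dᵗ (c≤d ∘ inj₁)) (sum-mono cᵇ dᵇ (c≤d ∘ inj₂))

sum-updateAt-suc : ∀ {k} (xs : Vec ℕ k) i → sum (updateAt xs i suc) ≡ suc (sum xs)
sum-updateAt-suc (x ∷ xs) zero    = refl
sum-updateAt-suc (x ∷ xs) (suc i) = trans (cong (x +_) (sum-updateAt-suc xs i)) (+-suc x _)

size-addGrain : ∀ {m n} v (c : Config m n) → size (addGrain v c) ≡ suc (size c)
size-addGrain (inj₁ i) (cᵗ , cᵇ) = cong (_+ sum cᵇ) (sum-updateAt-suc cᵗ i)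
size-addGrain (inj₂ j) (cᵗ , cᵇ) =
  trans (cong (sum cᵗ +_) (sum-updateAt-suc cᵇ j)) (+-suc (sum cᵗ) _)

infix 4 _⇝[_]_

-- `N` is only an upper bound on the number of steps, as `stay` accepts any `N`; one `N` can thus
-- serve all starting states.
data _⇝[_]_ {m n} .{{_ : NonZero n}} (s : Config m n) : ℕ → Config m n → Set where
  stay : ∀ {N} → s ⇝[ N ] s
  move : ∀ {N t} v → step s v ⇝[ N ] t → s ⇝[ suc N ] t

deficient⊎≥ : ∀ {m n} (c d : Config m n) → (∃[ v ] grains c v < grains d v) ⊎ d ≤ᶜ c
deficient⊎≥ (cᵗ , cᵇ) (dᵗ , dᵇ)
  with Fin.any? (λ i → lookup cᵗ i <? lookup dᵗ i) | Fin.any? (λ j → lookup cᵇ j <? lookup dᵇ j)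
... | yes (i , p) | _           = inj₁ (inj₁ i , p)
... | no _        | yes (j , p) = inj₁ (inj₂ j , p)
... | no ¬p       | no ¬q       = inj₂ λ where
  (inj₁ i) → ≮⇒≥ λ p → ¬p (i , p)
  (inj₂ j) → ≮⇒≥ λ q → ¬q (j , q)

addGrain≤ : ∀ {m n} v (c d : Config m n) → c ≤ᶜ d → grains c v < grains d v → addGrain v c ≤ᶜ d
addGrain≤ v c d c≤d cᵥ<dᵥ u with u ≟ᵛ v
... | yes refl = subst (_≤ grains d v) (sym (grains-addGrain v c)) cᵥ<dᵥ
... | no u≢v   = subst (_≤ grains d u) (sym (grains-addGrain′ u v c u≢v)) (c≤d u)

-- The grains that `c` lacks compared with `d` are dropped one per step; by `step-stabilise` the
-- chain stands at the stabilisation of what has accumulated. The size bound leaves enough steps.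
stabilise-reachable : ∀ {m n} .{{_ : NonZero n}} (c d : Config m n) N → c ≤ᶜ d →
                      size d ≤ N + size c → stabilise c ⇝[ N ] stabilise d
stabilise-reachable c d N c≤d bound with deficient⊎≥ c d
... | inj₂ d≤c = subst (λ x → stabilise c ⇝[ N ] stabilise x)
                       (grains-injective c d λ v → ≤-antisym (c≤d v) (d≤c v)) stay
stabilise-reachable c d zero c≤d bound | inj₁ (v , cᵥ<dᵥ) =
  contradiction (subst (_≤ size d) (size-addGrain v c)
                       (size-mono (addGrain v c) d (addGrain≤ v c d c≤d cᵥ<dᵥ)))
                (≤⇒≯ bound)
stabilise-reachable c d (suc N) c≤d bound | inj₁ (v , cᵥ<dᵥ) =
  move v (subst (_⇝[ N ] stabilise d) (sym (step-stabilise c v))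
    (stabilise-reachable (addGrain v c) d N (addGrain≤ v c d c≤d cᵥ<dᵥ)
      (subst (size d ≤_)
             (sym (trans (cong (N +_) (size-addGrain v c)) (+-suc N (size c)))) bound)))

-- Forbidden configurations and burning

count-mono : ∀ {k} {P Q : ℕ → Set} (P? : Decidable P) (Q? : Decidable Q) (xs ys : Vec ℕ k) →
             (∀ i → P (lookup xs i) → Q (lookup ys i)) → count P? xs ≤ count Q? ys
count-mono P? Q? []       []       P⇒Q = z≤n
count-mono P? Q? (x ∷ xs) (y ∷ ys) P⇒Q with P? x | Q? y | count-mono P? Q? xs ys (P⇒Q ∘ suc)
... | yes _ | yes _ | ih = s≤s ih
... | yes p | no ¬q | _  = contradiction (P⇒Q zero p) ¬q
... | no _  | yes _ | ih = m≤n⇒m≤1+n ih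
... | no _  | no _  | ih = ih

count-updateAt : ∀ {k} {P : ℕ → Set} (P? : Decidable P) (xs : Vec ℕ k) i f →
                 count P? (updateAt xs i f) ≤ suc (count P? xs)
count-updateAt P? (x ∷ xs) zero    f with does (P? x) | does (P? (f x))
... | true  | true  = n≤1+n _
... | true  | false = m≤n⇒m≤1+n (n≤1+n _)
... | false | true  = ≤-refl
... | false | false = n≤1+n _
count-updateAt P? (x ∷ xs) (suc i) f with does (P? x)
... | true  = s≤s (count-updateAt P? xs i f)
... | false = count-updateAt P? xs i f

count-none : ∀ {k} {P : ℕ → Set} (P? : Decidable P) (xs : Vec ℕ k) →
             (∀ i → ¬ P (lookup xs i)) → count P? xs ≡ 0
count-none P? []       ¬P = refl
count-none P? (x ∷ xs) ¬P with P? x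
... | yes p = contradiction p (¬P zero)
... | no _  = count-none P? xs (¬P ∘ suc)

count-<0 : ∀ {k} (xs : Vec ℕ k) → count (_<? 0) xs ≡ 0
count-<0 xs = count-none (_<? 0) xs λ _ ()

-- Dhar's forbidden subconfigurations: such `a` tops and `b` bottoms span a subgraph without the
-- sink in which each vertex holds fewer grains than its degree there. `a > 0` is automatic, as no
-- vertex holds fewer than 0 grains.
Forbidden : ∀ {m n} → Config m n → Set
Forbidden (cᵗ , cᵇ) = ∃[ a ] ∃[ b ] (0 < b × a ≤ count (_<? b) cᵗ × b ≤ count (_<? a) cᵇ)

forbidden-antitone : ∀ {m n} (c d : Config m n) → c ≤ᶜ d → Forbidden d → Forbidden c
forbidden-antitone (cᵗ , cᵇ) (dᵗ , dᵇ) c≤d (a , b , 0<b , a≤ , b≤) =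
  a , b , 0<b ,
  ≤-trans a≤ (count-mono _ _ dᵗ cᵗ (λ i → ≤-<-trans (c≤d (inj₁ i)))) ,
  ≤-trans b≤ (count-mono _ _ dᵇ cᵇ (λ j → ≤-<-trans (c≤d (inj₂ j))))

count-map-suc : ∀ {k} (xs : Vec ℕ k) x →
                count (_<? suc x) (map suc xs) ≤ count (_<? x) xs
count-map-suc xs x = count-mono _ _ (map suc xs) xs
  λ i p → s<s⁻¹ (subst (_< suc x) (lookup-map i suc xs) p)

-- Leave `v` out of the forbidden set. If `v` is a top vertex, at least `a - 1` of the counted tops
-- remain, and the bottoms held one grain less before, hence fewer than `a - 1`. The bottom case
-- exchanges `a` and `b`.
forbidden-topple : ∀ {m n} v (c : Config m n) → Forbidden (topple v c) → Forbidden c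
forbidden-topple (inj₁ i) (cᵗ , cᵇ) (zero , b , 0<b , a≤ , b≤) =
  contradiction (≤-trans 0<b (≤-trans b≤ (≤-reflexive (count-<0 (map suc cᵇ))))) λ ()
forbidden-topple (inj₁ i) (cᵗ , cᵇ) (suc a , b , 0<b , a≤ , b≤) =
  a , b , 0<b ,
  s≤s⁻¹ (≤-trans a≤ (count-updateAt (_<? b) cᵗ i _)) ,
  ≤-trans b≤ (count-map-suc cᵇ a)
-- Here `b - 1` would be 0. But every top vertex has just received a grain, so `a = 0`, and no
-- bottom vertex holds fewer than 0.
forbidden-topple (inj₂ j) (cᵗ , cᵇ) (a , suc zero , 0<b , a≤ , b≤)
  with z≤n ← ≤-trans a≤ (≤-trans (count-map-suc cᵗ 0) (≤-reflexive (count-<0 cᵗ))) =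
  contradiction (≤-trans b≤ (≤-reflexive (count-<0 (updateAt cᵇ j _)))) λ ()
forbidden-topple (inj₂ j) (cᵗ , cᵇ) (a , suc (suc b) , 0<b , a≤ , b≤) =
  a , suc b , z<s ,
  ≤-trans a≤ (count-map-suc cᵗ (suc b)) ,
  s≤s⁻¹ (≤-trans b≤ (count-updateAt (_<? a) cᵇ j _))

forbidden-⟶* : ∀ {m n} (c d : Config m n) → c ⟶* d → Forbidden d → Forbidden c
forbidden-⟶* c d ε                      f = f
forbidden-⟶* c d (toppling v _ ◅ v⟶*d) f = forbidden-topple v c (forbidden-⟶* (topple v c) d v⟶*d f)

forbidden-step : ∀ {m n} .{{_ : NonZero n}} (s : Config m n) v → Forbidden (step s v) → Forbidden s
forbidden-step s v f =
  forbidden-antitone s (addGrain v s) (c≤addGrain v s)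
    (forbidden-⟶* (addGrain v s) (step s v) (⟶*-stabilise (addGrain v s)) f)

-- `a` is bounded by a number of top vertices, so `a ≤ m`.
¬forbidden-high : ∀ {m n} (c : Config m n) → (∀ j → m ≤ grains c (inj₂ j)) → ¬ Forbidden c
¬forbidden-high (cᵗ , cᵇ) high (a , b , 0<b , a≤ , b≤) =
  contradiction (≤-trans 0<b (≤-trans b≤ (≤-reflexive (count-none (_<? a) cᵇ
    λ j → ≤⇒≯ (≤-trans a≤ (≤-trans (count≤n (_<? b) cᵗ) (high j))))))) λ ()

-- The burning algorithm

debt : ∀ {k} → Subset k → Fin k → ℕ → ℕ
debt S i d = if lookup S i then d else 0

∣[]≔inside∣ : ∀ {k} (S : Subset k) i → lookup S i ≡ outside → ∣ S [ i ]≔ inside ∣ ≡ suc ∣ S ∣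
∣[]≔inside∣ (outside ∷ S) zero    eq = refl
∣[]≔inside∣ (inside  ∷ S) (suc i) eq = cong suc (∣[]≔inside∣ S i eq)
∣[]≔inside∣ (outside ∷ S) (suc i) eq = ∣[]≔inside∣ S i eq

count-outside : ∀ {k} {P : ℕ → Set} (P? : Decidable P) (S : Subset k) (xs : Vec ℕ k) →
                (∀ i → lookup S i ≡ outside → P (lookup xs i)) → k ≤ ∣ S ∣ + count P? xs
count-outside P? []            []       out = z≤n
count-outside {suc k} P? (inside  ∷ S) (x ∷ xs) out with does (P? x)
... | true  = s≤s (≤-trans (count-outside P? S xs (out ∘ suc)) (+-monoʳ-≤ ∣ S ∣ (n≤1+n _)))
... | false = s≤s (count-outside P? S xs (out ∘ suc))
count-outside {suc k} P? (outside ∷ S) (x ∷ xs) out with P? x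
... | yes _ = subst (suc k ≤_) (sym (+-suc ∣ S ∣ _)) (s≤s (count-outside P? S xs (out ∘ suc)))
... | no ¬p = contradiction (out zero refl) ¬p

-- On one side, with vertices of degree d, ys arises from xs when the vertices in S topple once
-- and each vertex receives t grains.
Burnt : ∀ {k} → Vec ℕ k → Vec ℕ k → Subset k → ℕ → ℕ → Set
Burnt xs ys S d t = ∀ i → lookup ys i + debt S i d ≡ lookup xs i + t

burnt-receive : ∀ {k} (xs ys : Vec ℕ k) (S : Subset k) {d t} →
                Burnt xs ys S d t → Burnt xs (map suc ys) S d (suc t)
burnt-receive xs ys S {d} {t} burnt i = begin
  lookup (map suc ys) i + debt S i d  ≡⟨ cong (_+ debt S i d) (lookup-map i suc ys) ⟩
  suc (lookup ys i + debt S i d)      ≡⟨ cong suc (burnt i) ⟩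
  suc (lookup xs i + t)               ≡⟨ +-suc (lookup xs i) t ⟨
  lookup xs i + suc t                 ∎
  where open ≡-Reasoning

burnt-topple : ∀ {k} (xs ys : Vec ℕ k) (S : Subset k) {d t} i →
               lookup S i ≡ outside → d ≤ lookup ys i →
               Burnt xs ys S d t → Burnt xs (updateAt ys i (_∸ d)) (S [ i ]≔ inside) d t
burnt-topple xs ys S {d} {t} i out d≤yᵢ burnt j with j Fin.≟ i
... | no j≢i rewrite lookup∘updateAt′ j i {_∸ d} j≢i ys | lookup∘updateAt′ j i {const inside} j≢i S
      = burnt j
... | yes refl rewrite lookup∘updateAt i {_∸ d} ys | lookup∘updateAt i {const inside} S = begin
  (lookup ys i ∸ d) + d       ≡⟨ m∸n+n≡m d≤yᵢ ⟩
  lookup ys i                 ≡⟨ +-identityʳ (lookup ys i) ⟨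
  lookup ys i + 0             ≡⟨ cong (λ s → lookup ys i + (if s then d else 0)) out ⟨
  lookup ys i + debt S i d    ≡⟨ burnt i ⟩
  lookup xs i + t             ∎
  where open ≡-Reasoning

burnt-all : ∀ {k} (xs ys : Vec ℕ k) (S : Subset k) {d} → ∣ S ∣ ≡ k → Burnt xs ys S d d → ys ≡ xs
burnt-all xs ys S {d} full burnt = lookup-injective ys xs λ i →
  +-cancelʳ-≡ d _ _ (subst (λ s → lookup ys i + (if s then d else 0) ≡ lookup xs i + d)
    (trans (cong (λ S → lookup S i) (∣p∣≡n⇒p≡⊤ {p = S} full)) (lookup-replicate i inside))
    (burnt i))

-- A vertex outside `S` now has `x + t` grains, and being stuck means `x + t < d`. In `burning`,
-- `d ∸ t` is the number of unburnt vertices on the other side.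
burnt-stuck : ∀ {k} (xs ys : Vec ℕ k) (S : Subset k) {d t} → Burnt xs ys S d t →
              ¬ (∃[ i ] (lookup S i ≡ outside × d ≤ lookup ys i)) →
              k ∸ ∣ S ∣ ≤ count (_<? d ∸ t) xs
burnt-stuck {k} xs ys S {d} {t} burnt stuck =
  m≤n+o⇒m∸n≤o k ∣ S ∣ (count-outside (_<? d ∸ t) S xs λ i out →
    m+n≤o⇒m≤o∸n (suc (lookup xs i))
      (subst (_< d) (yᵢ≡xᵢ+t i out) (≰⇒> λ d≤yᵢ → stuck (i , out , d≤yᵢ))))
  where
  open ≡-Reasoning
  yᵢ≡xᵢ+t : ∀ i → lookup S i ≡ outside → lookup ys i ≡ lookup xs i + t
  yᵢ≡xᵢ+t i out = begin
    lookup ys i               ≡⟨ +-identityʳ (lookup ys i) ⟨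
    lookup ys i + 0           ≡⟨ cong (λ s → lookup ys i + (if s then d else 0)) out ⟨
    lookup ys i + debt S i d  ≡⟨ burnt i ⟩
    lookup xs i + t           ∎

sinkTopple : ∀ {m n} → Config m n → Config m n
sinkTopple (cᵗ , cᵇ) = cᵗ , map suc cᵇ

c≤sinkTopple : ∀ {m n} (c : Config m n) → c ≤ᶜ sinkTopple c
c≤sinkTopple (cᵗ , cᵇ) (inj₁ i) = ≤-refl
c≤sinkTopple (cᵗ , cᵇ) (inj₂ j) = lookup-map-suc cᵇ j

-- The burning algorithm: when the sink topples, every vertex topples exactly once.
burning : ∀ {m n} .{{_ : NonZero n}} (c : Config m n) → ¬ Forbidden c →
          sinkTopple c ⟶* c
burning {m} {n} c@(cᵗ , cᵇ) ¬forbidden = go ⊥ ⊥ (cᵗ , map suc cᵇ)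
  (subst (Burnt cᵗ cᵗ ⊥ n) (sym (∣⊥∣≡0 n)) (burnt-⊥ cᵗ))
  (burnt-receive cᵇ cᵇ (⊥ {n}) (subst (Burnt cᵇ cᵇ ⊥ (suc m)) (sym (∣⊥∣≡0 m)) (burnt-⊥ cᵇ)))
  (<-wellFounded _)
  where
  burnt-⊥ : ∀ {k d} (xs : Vec ℕ k) → Burnt xs xs ⊥ d 0
  burnt-⊥ {k} {d} xs i = cong (λ s → lookup xs i + (if s then d else 0))
                              (lookup-replicate {n = k} i outside)

  -- `S` and `T` are the burnt vertices: each top has received one grain per vertex of `T`, each
  -- bottom one per vertex of `S` and one from the sink.
  go : ∀ (S : Subset m) (T : Subset n) (d : Config m n) →
       Burnt cᵗ (proj₁ d) S n ∣ T ∣ → Burnt cᵇ (proj₂ d) T (suc m) (suc ∣ S ∣) →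
       Acc _<_ (potential d) → d ⟶* c
  go S T d@(dᵗ , dᵇ) burntᵗ burntᵇ (acc rs)
    with Fin.any? (λ i → (lookup S i Bool.≟ outside) ×-dec (n ≤? lookup dᵗ i))
       | Fin.any? (λ j → (lookup T j Bool.≟ outside) ×-dec (suc m ≤? lookup dᵇ j))
  ... | yes (i , out , p) | _ = toppling (inj₁ i) p ◅
        go (S [ i ]≔ inside) T _
           (burnt-topple cᵗ dᵗ S i out p burntᵗ)
           (subst (Burnt cᵇ (map suc dᵇ) T (suc m) ∘ suc) (sym (∣[]≔inside∣ S i out))
                  (burnt-receive cᵇ dᵇ T burntᵇ))
           (rs (topple-< d (inj₁ i) p))
  ... | no _ | yes (j , out , p) = toppling (inj₂ j) p ◅
        go S (T [ j ]≔ inside) _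
           (subst (Burnt cᵗ (map suc dᵗ) S n) (sym (∣[]≔inside∣ T j out))
                  (burnt-receive cᵗ dᵗ S burntᵗ))
           (burnt-topple cᵇ dᵇ T j out p burntᵇ)
           (rs (topple-< d (inj₂ j) p))
  -- If the fire stopped early, the unburnt vertices would make `c` forbidden, unless `b = 0`; and
  -- then `a ≤ 0` as well.
  ... | no stuckᵗ | no stuckᵇ = subst (_⟶* c) (sym d≡c) ε
    where
    a≤ : m ∸ ∣ S ∣ ≤ count (_<? n ∸ ∣ T ∣) cᵗ
    a≤ = burnt-stuck cᵗ dᵗ S burntᵗ stuckᵗ
    -- The sink's grain offsets the sink's edge: `suc m ∸ suc ∣ S ∣` reduces to `m ∸ ∣ S ∣`.
    b≤ : n ∸ ∣ T ∣ ≤ count (_<? m ∸ ∣ S ∣) cᵇ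
    b≤ = burnt-stuck cᵇ dᵇ T burntᵇ stuckᵇ
    b≡0 : n ∸ ∣ T ∣ ≡ 0
    b≡0 = n≤0⇒n≡0 (≮⇒≥ λ 0<b → ¬forbidden (_ , _ , 0<b , a≤ , b≤))
    a≡0 : m ∸ ∣ S ∣ ≡ 0
    a≡0 = n≤0⇒n≡0 (≤-trans a≤ (≤-reflexive
      (trans (cong (λ b → count (_<? b) cᵗ) b≡0) (count-<0 cᵗ))))
    ∣S∣≡m : ∣ S ∣ ≡ m
    ∣S∣≡m = ≤-antisym (∣p∣≤n S) (m∸n≡0⇒m≤n a≡0)
    ∣T∣≡n : ∣ T ∣ ≡ n
    ∣T∣≡n = ≤-antisym (∣p∣≤n T) (m∸n≡0⇒m≤n b≡0)
    d≡c : d ≡ c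
    d≡c = cong₂ _,_
      (burnt-all cᵗ dᵗ S ∣S∣≡m (subst (Burnt cᵗ dᵗ S n) ∣T∣≡n burntᵗ))
      (burnt-all cᵇ dᵇ T ∣T∣≡n (subst (Burnt cᵇ dᵇ T (suc m) ∘ suc) ∣S∣≡m burntᵇ))



-- Each sink toppling adds a grain to every bottom vertex, burning leads back, and added grains
-- create no forbidden pair, so this can be repeated.
raise-bottoms : ∀ {m n} .{{_ : NonZero n}} (c : Config m n) → ¬ Forbidden c → ∀ K →
                ∃[ d ] (d ⟶* c × ¬ Forbidden d × (∀ j → K ≤ grains d (inj₂ j)))
raise-bottoms c ¬f zero    = c , ε , ¬f , λ _ → z≤n
raise-bottoms c ¬f (suc K) =
  let d , d⟶*c , ¬fd , high = raise-bottoms c ¬f K in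
  sinkTopple d , burning d ¬fd ◅◅ d⟶*c ,
  ¬fd ∘ forbidden-antitone d (sinkTopple d) (c≤sinkTopple d) ,
  λ j → subst (suc K ≤_) (sym (lookup-map j suc (proj₂ d))) (s≤s (high j))

-- Every toppling of `j` costs it `m + 1` grains and gives each top vertex one; the induction keeps
-- `suc m` in reserve for the last toppling.
pour : ∀ {m n} (j : Fin n) r M (c : Config m n) → (∀ j → r * suc m + M ≤ grains c (inj₂ j)) →
       ∃[ d ] (c ⟶* d × (∀ i → r ≤ grains d (inj₁ i)) × (∀ j → M ≤ grains d (inj₂ j)))
pour     j zero    M c high = c , ε , (λ _ → z≤n) , high
pour {m} j (suc r) M c high
  with d@(dᵗ , dᵇ) , c⟶*d , tops , bottoms ← pour j r (suc m + M) c
         (λ j → subst (_≤ grains c (inj₂ j))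
                      (trans (cong (_+ M) (+-comm (suc m) (r * suc m)))
                             (+-assoc (r * suc m) (suc m) M))
                      (high j))
  = topple (inj₂ j) d ,
    c⟶*d ◅◅ toppling (inj₂ j) (m+n≤o⇒m≤o (suc m) (bottoms j)) ◅ ε ,
    (λ i → subst (suc r ≤_) (sym (lookup-map i suc dᵗ)) (s≤s (tops i))) ,
    bottoms′
  where
  bottoms′ : ∀ i → M ≤ lookup (updateAt dᵇ j (_∸ suc m)) i
  bottoms′ i with i Fin.≟ j
  ... | no i≢j   = subst (M ≤_) (sym (lookup∘updateAt′ i j i≢j dᵇ)) (m+n≤o⇒n≤o (suc m) (bottoms i))
  ... | yes refl = subst (M ≤_) (sym (lookup∘updateAt i dᵇ))
                         (m+n≤o⇒m≤o∸n M (subst (_≤ lookup dᵇ i) (+-comm (suc m) M) (bottoms i)))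

-- Repeated burning raises the bottom vertices arbitrarily; toppling one of them n times then
-- raises the top vertices.
above-stable : ∀ {m n} .{{_ : NonZero n}} (c : Config m n) → Stable c → ¬ Forbidden c →
               ∃[ d ] (d ⟶* c × (∀ s → Stable s → s ≤ᶜ d))
above-stable {m} {n} c stable ¬f =
  -- The `n` topplings cost `n * suc m`. The `m` grains left on each bottom and the `n` received by
  -- each top are at least what a stable configuration can hold.
  let e , e⟶*c , _ , high = raise-bottoms c ¬f (n * suc m + m)
      d , e⟶*d , tops , bottoms = pour (Fin.fromℕ< (>-nonZero⁻¹ n)) n m e high
  in d , strip* stable e⟶*c e⟶*d , λ where
    s sStable (inj₁ i) → ≤-trans (<⇒≤ (sStable (inj₁ i))) (tops i)
    s sStable (inj₂ j) → ≤-trans (s≤s⁻¹ (sStable (inj₂ j))) (bottoms j)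

-- Counting the draws

total : ∀ {a} {A : Set a} → (A → ℕ) → List A → ℕ
total f xs = sumˡ (List.map f xs)

module _ {a} {A : Set a} where

  total-mono : ∀ {f g : A → ℕ} → (∀ x → f x ≤ g x) → ∀ xs → total f xs ≤ total g xs
  total-mono f≤g List.[]       = z≤n
  total-mono f≤g (x List.∷ xs) = +-mono-≤ (f≤g x) (total-mono f≤g xs)

  total-strict : ∀ {f g : A → ℕ} → (∀ x → f x ≤ g x) → ∀ {x xs} → x ∈ xs → f x < g x →
                 total f xs < total g xs
  total-strict f≤g {xs = x List.∷ xs} (ListAny.here refl) fx<gx =
    +-mono-<-≤ fx<gx (total-mono f≤g xs)
  total-strict f≤g {xs = x List.∷ xs} (ListAny.there x∈xs) fx<gx =
    +-mono-≤-< (f≤g x) (total-strict f≤g x∈xs fx<gx)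

  ≤total : ∀ (f : A → ℕ) {x xs} → x ∈ xs → f x ≤ total f xs
  ≤total f {xs = x List.∷ xs} (ListAny.here refl)  = m≤m+n (f x) _
  ≤total f {xs = x List.∷ xs} (ListAny.there x∈xs) = ≤-trans (≤total f x∈xs) (m≤n+m _ (f x))

  total-const : ∀ k (xs : List A) → total (const k) xs ≡ length xs * k
  total-const k List.[]       = refl
  total-const k (x List.∷ xs) = cong (k +_) (total-const k xs)

  total-+ : ∀ (f g : A → ℕ) xs → total f xs + total g xs ≡ total (λ x → f x + g x) xs
  total-+ f g List.[]       = refl
  total-+ f g (x List.∷ xs) =
    trans (lemma (f x) (total f xs) (g x) (total g xs)) (cong (f x + g x +_) (total-+ f g xs))
    where
    lemma : ∀ a b c d → (a + b) + (c + d) ≡ (a + c) + (b + d)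
    lemma = solve-∀

  total-*ʳ : ∀ (f : A → ℕ) k xs → total (λ x → f x * k) xs ≡ total f xs * k
  total-*ʳ f k List.[]       = refl
  total-*ʳ f k (x List.∷ xs) =
    trans (cong (f x * k +_) (total-*ʳ f k xs)) (sym (*-distribʳ-+ k (f x) (total f xs)))

  total-cong : ∀ {f g : A → ℕ} → (∀ x → f x ≡ g x) → ∀ xs → total f xs ≡ total g xs
  total-cong f≡g xs = cong sumˡ (List.map-cong f≡g xs)

length-filter-map : ∀ {a b} {A : Set a} {B : Set b} {P : B → Set}
                    (P? : Decidable P) (f : A → B) xs →
                    length (filter P? (List.map f xs)) ≡ length (filter (P? ∘ f) xs)
length-filter-map P? f List.[] = refl
length-filter-map P? f (x List.∷ xs) with does (P? (f x))
... | true  = cong suc (length-filter-map P? f xs)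
... | false = length-filter-map P? f xs

length-filter-cartesianProductWith :
  ∀ {a b c} {A : Set a} {B : Set b} {C : Set c} {P : C → Set}
  (P? : Decidable P) (f : A → B → C) xs ys →
  length (filter P? (cartesianProductWith f xs ys)) ≡ total (λ x → length (filter (P? ∘ f x) ys)) xs
length-filter-cartesianProductWith P? f List.[]       ys = refl
length-filter-cartesianProductWith P? f (x List.∷ xs) ys = begin
  length (filter P? (List.map (f x) ys List.++ cartesianProductWith f xs ys))
    ≡⟨ cong length (filter-++ P? (List.map (f x) ys) _) ⟩
  length (filter P? (List.map (f x) ys) List.++ filter P? (cartesianProductWith f xs ys))
    ≡⟨ length-++ (filter P? (List.map (f x) ys)) ⟩
  length (filter P? (List.map (f x) ys)) + length (filter P? (cartesianProductWith f xs ys))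
    ≡⟨ cong₂ _+_ (length-filter-map P? (f x) ys) (length-filter-cartesianProductWith P? f xs ys) ⟩
  length (filter (P? ∘ f x) ys) + total (λ x → length (filter (P? ∘ f x) ys)) xs ∎
  where open ≡-Reasoning

length-cartesianProductWith :
  ∀ {a b c} {A : Set a} {B : Set b} {C : Set c} (f : A → B → C) xs ys →
  length (cartesianProductWith f xs ys) ≡ length xs * length ys
length-cartesianProductWith f List.[]       ys = refl
length-cartesianProductWith f (x List.∷ xs) ys =
  trans (length-++ (List.map (f x) ys))
        (cong₂ _+_ (length-map (f x) ys) (length-cartesianProductWith f xs ys))

length-vertices : ∀ m n → length (vertices m n) ≡ m + n
length-vertices m n = begin
  length (vertices m n)
    ≡⟨ length-++ (List.map inj₁ (List.allFin m)) ⟩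
  length (List.map inj₁ (List.allFin m)) + length (List.map inj₂ (List.allFin n))
    ≡⟨ cong₂ _+_ (length-map inj₁ (List.allFin m)) (length-map inj₂ (List.allFin n)) ⟩
  length (List.allFin m) + length (List.allFin n)
    ≡⟨ cong₂ _+_ (length-tabulate {n = m} id) (length-tabulate {n = n} id) ⟩
  m + n ∎
  where open ≡-Reasoning

∈-vertices : ∀ {m n} (v : Vertex m n) → v ∈ vertices m n
∈-vertices (inj₁ i) = ∈-++⁺ˡ (∈-map⁺ inj₁ (∈-allFin i))
∈-vertices {m} (inj₂ j) = ∈-++⁺ʳ (List.map inj₁ (List.allFin m)) (∈-map⁺ inj₂ (∈-allFin j))

total-vertices-const : ∀ m n k → total (const k) (vertices m n) ≡ (m + n) * k
total-vertices-const m n k =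
  trans (total-const k (vertices m n)) (cong (_* k) (length-vertices m n))

length-draws : ∀ m n L → length (draws m n L) ≡ (m + n) ^ L
length-draws m n zero    = refl
length-draws m n (suc L) = begin
  length (cartesianProductWith _∷_ (vertices m n) (draws m n L))
    ≡⟨ length-cartesianProductWith _∷_ (vertices m n) (draws m n L) ⟩
  length (vertices m n) * length (draws m n L)
    ≡⟨ cong₂ _*_ (length-vertices m n) (length-draws m n L) ⟩
  (m + n) ^ suc L ∎
  where open ≡-Reasoning

-- Draws that miss a given state

module _ {m n} .{{_ : NonZero n}} (c : Config m n) where

  -- At `s = c` this is the numerator of `Pr (visits? c T)`; recursion on the first draw needs an
  -- arbitrary start.
  hits : ℕ → ℕ → Config m n → ℕ
  hits T N s =
    length (filter (λ vs → Any.any? (_≟ᶜ c) (drop T (trajectory s vs))) (draws m n (T + N)))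

  mutual
    -- The complementary count, given by recursion on the draws rather than by filtering, so that
    -- bounds follow by induction.
    misses : ℕ → ℕ → Config m n → ℕ
    misses (suc T) N       s = total (λ v → misses T N (step s v)) (vertices m n)
    misses zero    zero    s = 1
    misses zero    (suc N) s = total (λ v → misses₀ N (step s v)) (vertices m n)

    -- The state s itself counts as a visit.
    misses₀ : ℕ → Config m n → ℕ
    misses₀ N s = if does (s ≟ᶜ c) then 0 else misses 0 N s

  hits₀ : ℕ → Config m n → ℕ
  hits₀ N s = length (filter (λ vs → Any.any? (_≟ᶜ c) (s ∷ trajectory s vs)) (draws m n N))

  misses₀-visited : ∀ N s → s ≡ c → misses₀ N s ≡ 0
  misses₀-visited N s s≡c =
    cong (λ b → if b then 0 else misses 0 N s) (dec-true (s ≟ᶜ c) s≡c)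

  misses₀-unvisited : ∀ N s → s ≢ c → misses₀ N s ≡ misses 0 N s
  misses₀-unvisited N s s≢c =
    cong (λ b → if b then 0 else misses 0 N s) (dec-false (s ≟ᶜ c) s≢c)

  mutual
    hits+misses : ∀ T N s → hits T N s + misses T N s ≡ (m + n) ^ (T + N)
    hits+misses zero zero s = refl
    hits+misses (suc T) N s = trans (cong (_+ misses (suc T) N s)
        (length-filter-cartesianProductWith _ _∷_ (vertices m n) (draws m n (T + N))))
      (total-draws (λ v → hits T N (step s v)) (λ v → misses T N (step s v)) (T + N)
                   (λ v → hits+misses T N (step s v)))
    hits+misses zero (suc N) s = trans (cong (_+ misses zero (suc N) s)
        (length-filter-cartesianProductWith _ _∷_ (vertices m n) (draws m n N)))
      (total-draws (λ v → hits₀ N (step s v)) (λ v → misses₀ N (step s v)) N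
                   (λ v → hits₀+misses₀ N (step s v)))

    hits₀+misses₀ : ∀ N s → hits₀ N s + misses₀ N s ≡ (m + n) ^ N
    hits₀+misses₀ N s = visited⊎not (s ≟ᶜ c)
      where
      open ≡-Reasoning
      visited⊎not : Dec (s ≡ c) → hits₀ N s + misses₀ N s ≡ (m + n) ^ N
      visited⊎not (yes s≡c) = begin
        hits₀ N s + misses₀ N s  ≡⟨ cong (hits₀ N s +_) (misses₀-visited N s s≡c) ⟩
        hits₀ N s + 0            ≡⟨ +-identityʳ (hits₀ N s) ⟩
        hits₀ N s                ≡⟨ cong length (filter-all _
                                      (All.universal (λ vs → here s≡c) (draws m n N))) ⟩
        length (draws m n N)     ≡⟨ length-draws m n N ⟩
        (m + n) ^ N              ∎
      visited⊎not (no s≢c) = begin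
        hits₀ N s + misses₀ N s    ≡⟨ cong₂ _+_ (cong length (filter-≐ _ _ unvisited (draws m n N)))
                                                (misses₀-unvisited N s s≢c) ⟩
        hits 0 N s + misses 0 N s  ≡⟨ hits+misses 0 N s ⟩
        (m + n) ^ N                ∎
        where
        unvisited : (λ vs → Any (_≡ c) (s ∷ trajectory s vs)) ≐
                    (λ vs → Any (_≡ c) (trajectory s vs))
        unvisited = (λ where (here s≡c) → contradiction s≡c s≢c; (there any) → any) , there

    total-draws : ∀ (h f : Vertex m n → ℕ) L → (∀ v → h v + f v ≡ (m + n) ^ L) →
                  total h (vertices m n) + total f (vertices m n) ≡ (m + n) ^ suc L
    total-draws h f L eq = begin
      total h (vertices m n) + total f (vertices m n) ≡⟨ total-+ h f (vertices m n) ⟩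
      total (λ v → h v + f v) (vertices m n)          ≡⟨ total-cong eq (vertices m n) ⟩
      total (const ((m + n) ^ L)) (vertices m n)      ≡⟨ total-vertices-const m n ((m + n) ^ L) ⟩
      (m + n) ^ suc L                                 ∎
      where open ≡-Reasoning

  misses₀≤ : ∀ N s → misses₀ N s ≤ (m + n) ^ N
  misses₀≤ N s = subst (misses₀ N s ≤_) (hits₀+misses₀ N s) (m≤n+m _ (hits₀ N s))

  m+n^>0 : ∀ N → 0 < (m + n) ^ N
  m+n^>0 N = m^n>0 (m + n) {{>-nonZero (m≤n⇒m≤o+n m (>-nonZero⁻¹ n))}} N

  mutual
    -- The draw `v` that begins a path to `c` contributes fewer than `(m + n) ^ N` misses, and no
    -- draw contributes more than that. The first step is separate because `misses 0` does not count
    -- the start as a visit.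
    misses-reachable : ∀ N s v → step s v ⇝[ N ] c → misses 0 (suc N) s < (m + n) ^ suc N
    misses-reachable N s v p = subst (misses 0 (suc N) s <_) (total-vertices-const m n _)
      (total-strict (λ v → misses₀≤ N (step s v)) (∈-vertices v) (misses₀-reachable N (step s v) p))

    misses₀-reachable : ∀ N s → s ⇝[ N ] c → misses₀ N s < (m + n) ^ N
    misses₀-reachable N       s stay       =
      subst (_< (m + n) ^ N) (sym (misses₀-visited N s refl)) (m+n^>0 N)
    misses₀-reachable (suc N) s (move v p) with s ≟ᶜ c
    ... | yes s≡c = m+n^>0 (suc N)
    ... | no _    = misses-reachable N s v p

  -- `T` is the length of the path. Its moves are one choice of the first `T` unwatched draws, so
  -- the misses from `t` are among those from `s`.
  misses-after-⇝ : ∀ {N s t} → s ⇝[ N ] t → ∃[ T ] (∀ N → misses 0 N t ≤ misses T N s)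
  misses-after-⇝         stay       = 0 , λ N → ≤-refl
  misses-after-⇝ {s = s} (move v p) =
    let T , bound = misses-after-⇝ p in
    suc T , λ N → ≤-trans (bound N) (≤total (λ v → misses T N (step s v)) (∈-vertices v))

  -- Non-forbidden states only lead to non-forbidden ones, so `c` is never met and every draw is a
  -- miss.
  misses-¬forbidden : Forbidden c → ∀ N s → ¬ Forbidden s → (m + n) ^ N ≤ misses 0 N s
  misses-¬forbidden fc zero    s ¬fs = ≤-refl
  misses-¬forbidden fc (suc N) s ¬fs = subst (_≤ misses 0 (suc N) s) (total-vertices-const m n _)
    (total-mono (λ v → subst ((m + n) ^ N ≤_)
                         (sym (misses₀-unvisited N (step s v)
                                (λ s≡c → ¬fs (forbidden-step s v (subst Forbidden (sym s≡c) fc)))))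
                         (misses-¬forbidden fc N (step s v) (¬fs ∘ forbidden-step s v)))
                (vertices m n))

  -- The Markov property: a miss over `L + N` steps is a miss over `L` steps followed by one over
  -- `N` steps from the state reached, which is stable.
  misses-+ : ∀ L N M → (∀ s → Stable s → misses 0 N s ≤ M) →
             ∀ s → Stable s → misses 0 (L + N) s ≤ misses 0 L s * M
  misses-+ zero    N M bound s stable =
    subst (misses 0 N s ≤_) (sym (+-identityʳ M)) (bound s stable)
  misses-+ (suc L) N M bound s stable =
    subst (misses 0 (suc L + N) s ≤_) (total-*ʳ (λ v → misses₀ L (step s v)) M (vertices m n))
          (total-mono (λ v → misses₀-+ (step s v) (stabilise-stable _)) (vertices m n))
    where
    misses₀-+ : ∀ s → Stable s → misses₀ (L + N) s ≤ misses₀ L s * M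
    misses₀-+ s stable with s ≟ᶜ c
    ... | yes _ = z≤n
    ... | no _  = misses-+ L N M bound s stable

  misses-blocks : ∀ L B → (∀ s → Stable s → misses 0 L s ≤ B) →
                  ∀ r s → Stable s → misses 0 (r * L) s ≤ B ^ r
  misses-blocks L B bound zero    s stable = ≤-refl
  misses-blocks L B bound (suc r) s stable =
    ≤-trans (misses-+ L (r * L) (B ^ r) (misses-blocks L B bound r) s stable)
            (*-monoˡ-≤ (B ^ r) (bound s stable))

  misses-burn-in : ∀ T N M → (∀ s → Stable s → misses 0 N s ≤ M) →
                   ∀ s → Stable s → misses T N s ≤ (m + n) ^ T * M
  misses-burn-in zero    N M bound s stable =
    subst (misses 0 N s ≤_) (sym (+-identityʳ M)) (bound s stable)
  misses-burn-in (suc T) N M bound s stable =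
    ≤-trans (total-mono (λ v → misses-burn-in T N M bound (step s v) (stabilise-stable _))
                        (vertices m n))
            (≤-reflexive (trans (total-vertices-const m n _)
                                (sym (*-assoc (m + n) ((m + n) ^ T) M))))

-- Bernoulli's inequality `(1 + 1/B)^r ≥ 1 + r/B` with denominators cleared.
bernoulli : ∀ B r → B ^ r * (B + r) ≤ suc B ^ r * B
bernoulli B zero    = ≤-reflexive (cong (1 *_) (+-identityʳ B))
bernoulli B (suc r) = begin
  B * B ^ r * (B + suc r)        ≤⟨ m≤m+n _ (B ^ r * r) ⟩
  B * B ^ r * (B + suc r) + B ^ r * r  ≡⟨ lemma B (B ^ r) r ⟩
  suc B * (B ^ r * (B + r))      ≤⟨ *-monoʳ-≤ (suc B) (bernoulli B r) ⟩
  suc B * (suc B ^ r * B)        ≡⟨ *-assoc (suc B) (suc B ^ r) B ⟨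
  suc B ^ suc r * B              ∎
  where
  open ≤-Reasoning
  lemma : ∀ b p r → b * p * (b + (1 + r)) + p * r ≡ (1 + b) * (p * (b + r))
  lemma = solve-∀

power-dominates : ∀ B q → ∃[ r ] B ^ r * q ≤ suc B ^ r
power-dominates zero      q = 1 , z≤n
power-dominates B@(suc _) q = r , *-cancelʳ-≤ (B ^ r * q) (suc B ^ r) B (begin
  B ^ r * q * B      ≡⟨ *-assoc (B ^ r) q B ⟩
  B ^ r * r          ≤⟨ *-monoʳ-≤ (B ^ r) (m≤n+m r B) ⟩
  B ^ r * (B + r)    ≤⟨ bernoulli B r ⟩
  suc B ^ r * B      ∎)
  where
  open ≤-Reasoning
  -- Chosen so that `B + r ≥ q * B`, which lets the factor `B` be cancelled after `bernoulli`.
  r = q * B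

-- As `h = D - f`, the left side says `f / D ≤ p / (q + 1)`. Cross-multiplied over the integers,
-- both inequalities have the same difference of sides, namely `difference`.
1-δ≤⇔ : ∀ p q h f D .{{_ : NonZero D}} → h + f ≡ D →
        (1ℚᵘ ℚᵘ.- mkℚᵘ (ℤ.+ p) q ℚᵘ.≤ (ℤ.+ h) ℚᵘ./ D) ⇔ f * suc q ≤ p * D
1-δ≤⇔ p q h f D@(suc D′) h+f≡D = mk⇔
  (λ where (*≤* le) → ℤ.drop‿+≤+ (ℤ.0≤i-j⇒j≤i (subst (ℤ.0ℤ ℤ.≤_) difference (ℤ.i≤j⇒0≤j-i le))))
  (λ le → *≤* (ℤ.0≤i-j⇒j≤i (subst (ℤ.0ℤ ℤ.≤_) (sym difference) (ℤ.i≤j⇒0≤j-i (ℤ.+≤+ le)))))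
  where
  open ≡-Reasoning
  lemma : ∀ p q h f → h ℤ.* q ℤ.- (ℤ.1ℤ ℤ.* q ℤ.+ (ℤ.- p) ℤ.* ℤ.1ℤ) ℤ.* (h ℤ.+ f)
                    ≡ p ℤ.* (h ℤ.+ f) ℤ.- f ℤ.* q
  lemma = ℤ.solve-∀
  difference : (ℤ.+ h) ℤ.* (ℤ.+ (1 * suc q))
                 ℤ.- (ℤ.1ℤ ℤ.* (ℤ.+ suc q) ℤ.+ (ℤ.- (ℤ.+ p)) ℤ.* ℤ.1ℤ) ℤ.* (ℤ.+ D)
             ≡ ℤ.+ (p * D) ℤ.- ℤ.+ (f * suc q)
  difference = begin
    _ ≡⟨ cong₂ (λ x y → (ℤ.+ h) ℤ.* (ℤ.+ x)
                          ℤ.- (ℤ.1ℤ ℤ.* (ℤ.+ suc q) ℤ.+ (ℤ.- (ℤ.+ p)) ℤ.* ℤ.1ℤ) ℤ.* y)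
               (*-identityˡ (suc q)) D≡ ⟩
    _ ≡⟨ lemma (ℤ.+ p) (ℤ.+ suc q) (ℤ.+ h) (ℤ.+ f) ⟩
    _ ≡⟨ cong (λ y → (ℤ.+ p) ℤ.* y ℤ.- (ℤ.+ f) ℤ.* (ℤ.+ suc q)) (sym D≡) ⟩
    _ ≡⟨ cong₂ ℤ._-_ (sym (ℤ.pos-* p D)) (sym (ℤ.pos-* f (suc q))) ⟩
    _ ∎
    where
    D≡ : ℤ.+ D ≡ ℤ.+ h ℤ.+ ℤ.+ f
    D≡ = cong ℤ.+_ (sym h+f≡D)

-- The criterion

module ΣVec = CommutativeMonoidSum +-0-commutativeMonoid

indicator : ∀ {P : ℕ → Set} → Decidable P → ℕ → ℕ
indicator P? x = if does (P? x) then 1 else 0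

count≡sum : ∀ {k} {P : ℕ → Set} (P? : Decidable P) (xs : Vec ℕ k) →
            count P? xs ≡ ΣVec.sum (indicator P? ∘ lookup xs)
count≡sum P? []       = refl
count≡sum P? (x ∷ xs) with does (P? x)
... | true  = cong suc (count≡sum P? xs)
... | false = count≡sum P? xs

-- A sum of indicators in a commutative monoid is invariant under permutations.
count-↭ : ∀ {k} {P : ℕ → Set} (P? : Decidable P) (x̃ : Vector ℕ k) (xs : Vec ℕ k) →
          x̃ ↭ lookup xs → count P? (tabulate x̃) ≡ count P? xs
count-↭ P? x̃ xs (ρ , x̃∘ρ≗xs) = begin
  count P? (tabulate x̃)
    ≡⟨ count≡sum P? (tabulate x̃) ⟩
  ΣVec.sum (indicator P? ∘ lookup (tabulate x̃))
    ≡⟨ ΣVec.sum-cong-≗ (cong (indicator P?) ∘ lookup∘tabulate x̃) ⟩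
  ΣVec.sum (indicator P? ∘ x̃)
    ≡⟨ ΣVec.sum-permute (indicator P? ∘ x̃) ρ ⟩
  ΣVec.sum (indicator P? ∘ x̃ ∘ (ρ ⟨$⟩ʳ_))
    ≡⟨ ΣVec.sum-cong-≗ (cong (indicator P?) ∘ x̃∘ρ≗xs) ⟩
  ΣVec.sum (indicator P? ∘ lookup xs)
    ≡⟨ count≡sum P? xs ⟨
  count P? xs ∎
  where open ≡-Reasoning

≤count : ∀ {k} {P : ℕ → Set} (P? : Decidable P) (xs : Vec ℕ k) b → b ≤ k →
         (∀ i → toℕ i < b → P (lookup xs i)) → b ≤ count P? xs
≤count P? xs       zero    b≤k       initial = z≤n
≤count P? (x ∷ xs) (suc b) (s≤s b≤k) initial with P? x
... | yes _ = s≤s (≤count P? xs b b≤k λ i i<b → initial (suc i) (s<s i<b))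
... | no ¬p = contradiction (initial zero z<s) ¬p

count≤ : ∀ {k} {P : ℕ → Set} (P? : Decidable P) (xs : Vec ℕ k) b →
         (∀ i → P (lookup xs i) → toℕ i < b) → count P? xs ≤ b
count≤ P? xs       zero    initial = ≤-reflexive (count-none P? xs λ i p → n≮0 (initial i p))
count≤ P? []       (suc b) initial = z≤n
count≤ P? (x ∷ xs) (suc b) initial with does (P? x)
... | true  = s≤s (count≤ P? xs b λ i p → s<s⁻¹ (initial (suc i) p))
... | false = m≤n⇒m≤1+n (count≤ P? xs b λ i p → s<s⁻¹ (initial (suc i) p))

-- If `c̃ᵇ j < k cᵗ j`, all sorted entries up to `j` lie below `k cᵗ j`, which makes `k cᵗ j` and
-- `suc (toℕ j)` a forbidden pair.
¬forbidden⇔ : ∀ {m n} (cᵗ : Vec ℕ m) (cᵇ : Vec ℕ n) (c̃ᵇ : Vector ℕ n) →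
              IsNonDecreasingRearrangement c̃ᵇ cᵇ →
              (¬ Forbidden (cᵗ , cᵇ)) ⇔ (∀ j → c̃ᵇ j ≥ k cᵗ j)
¬forbidden⇔ {m} {n} cᵗ cᵇ c̃ᵇ sorted = mk⇔
  (λ ¬f j → ≮⇒≥ λ c̃ⱼ<kⱼ → ¬f
    ( k cᵗ j , suc (toℕ j) , z<s , ≤-refl
    , subst (suc (toℕ j) ≤_) (count-↭ (_<? k cᵗ j) c̃ᵇ cᵇ rearrangement)
        (≤count (_<? k cᵗ j) (tabulate c̃ᵇ) (suc (toℕ j)) (Fin.toℕ<n j) λ i i≤j →
          subst (_< k cᵗ j) (sym (lookup∘tabulate c̃ᵇ i))
                (≤-<-trans (nonDecreasing (s≤s⁻¹ i≤j)) c̃ⱼ<kⱼ))))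
  -- At index `b`, `a ≤ k cᵗ j ≤ c̃ᵇ j` leaves only the `b` sorted entries before `j` that can lie
  -- below `a`.
  λ { c̃≥k (a , suc b , 0<b , a≤ , b<count) →
      let b<n = ≤-trans b<count (count≤n (_<? a) cᵇ)
          j   = Fin.fromℕ< b<n
          j≡b = Fin.toℕ-fromℕ< b<n
          a≤c̃ⱼ = ≤-trans (subst (λ b → a ≤ count (_<? suc b) cᵗ) (sym j≡b) a≤) (c̃≥k j)
      in <⇒≱ b<count (subst (_≤ b) (count-↭ (_<? a) c̃ᵇ cᵇ rearrangement)
           (count≤ (_<? a) (tabulate c̃ᵇ) b λ i c̃ᵢ<a → ≰⇒> λ b≤i →
             <⇒≱ (subst (_< a) (lookup∘tabulate c̃ᵇ i) c̃ᵢ<a)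
                 (≤-trans a≤c̃ⱼ (nonDecreasing (subst (_≤ toℕ i) (sym j≡b) b≤i))))) }
  where open IsNonDecreasingRearrangement sorted

-- Recurrence and forbidden configurations

module _ {m n} .{{_ : NonZero n}} (c : Config m n) (stable : Stable c) where

  private
    K : ℕ
    K = m + n

  Pr-visits⇔ : ∀ p q T N → (1ℚᵘ ℚᵘ.- mkℚᵘ (ℤ.+ p) q ℚᵘ.≤ Pr (visits? c T {N})) ⇔
                           (misses c T N c * suc q ≤ p * K ^ (T + N))
  Pr-visits⇔ p q T N = 1-δ≤⇔ p q (hits c T N c) (misses c T N c) (K ^ (T + N))
    {{>-nonZero (m+n^>0 c (T + N))}} (hits+misses c T N c)

  -- Some path of `T` steps leads from `c` to a non-forbidden state, after which `c` is never met.
  -- So for every `N` a miss has probability at least `1 / K^T`, which contradicts recurrence at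
  -- `δ = 1 / (1 + K^T)`.
  recurrent⇒¬forbidden : DeterministicallyRecurrent c → ¬ Forbidden c
  recurrent⇒¬forbidden recurrent forbidden = <⇒≱ K^N>0 (+-cancelʳ-≤ (K ^ N * K ^ T) (K ^ N) 0 (begin
      K ^ N + K ^ N * K ^ T         ≡⟨ *-suc (K ^ N) (K ^ T) ⟨
      K ^ N * suc (K ^ T)           ≤⟨ *-monoˡ-≤ (suc (K ^ T)) K^N≤misses ⟩
      misses c T N c * suc (K ^ T)  ≤⟨ Equivalence.to (Pr-visits⇔ 1 (K ^ T) T N) (proj₂ visited) ⟩
      1 * K ^ (T + N)               ≡⟨ *-identityˡ _ ⟩
      K ^ (T + N)                   ≡⟨ ^-distribˡ-+-* K T N ⟩
      K ^ T * K ^ N                 ≡⟨ *-comm (K ^ T) (K ^ N) ⟩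
      K ^ N * K ^ T                 ∎))
    where
    open ≤-Reasoning
    d : Config m n
    d = proj₁ c , map (m +_) (proj₂ c)
    c≤d : c ≤ᶜ d
    c≤d (inj₁ i) = ≤-refl
    c≤d (inj₂ j) = subst (lookup (proj₂ c) j ≤_) (sym (lookup-map j (m +_) (proj₂ c))) (m≤n+m _ m)
    ¬fd : ¬ Forbidden (stabilise d)
    ¬fd f = ¬forbidden-high d
      (λ j → subst (m ≤_) (sym (lookup-map j (m +_) (proj₂ c))) (m≤m+n m _))
      (forbidden-⟶* d (stabilise d) (⟶*-stabilise d) f)
    c⇝d : c ⇝[ size d ] stabilise d
    c⇝d = subst (_⇝[ size d ] stabilise d) (stabilise-unique ε stable)
                (stabilise-reachable c d (size d) c≤d (m≤m+n (size d) (size c)))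
    T : ℕ
    T = proj₁ (misses-after-⇝ c c⇝d)
    bound : ∀ N → misses c 0 N (stabilise d) ≤ misses c T N c
    bound = proj₂ (misses-after-⇝ c c⇝d)
    visited : ∃[ N ] (1ℚᵘ ℚᵘ.- mkℚᵘ (ℤ.+ 1) (K ^ T) ℚᵘ.≤ Pr (visits? c T {N}))
    visited = recurrent T (mkℚᵘ (ℤ.+ 1) (K ^ T)) (*<* (ℤ.+<+ z<s))
    N : ℕ
    N = proj₁ visited
    K^N≤misses : K ^ N ≤ misses c T N c
    K^N≤misses = ≤-trans (misses-¬forbidden c forbidden N (stabilise d) ¬fd) (bound N)
    K^N>0 : 0 < K ^ N
    K^N>0 = m+n^>0 c N

  ¬forbidden⇒recurrent : ¬ Forbidden c → DeterministicallyRecurrent c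
  ¬forbidden⇒recurrent ¬f T (mkℚᵘ (ℤ.+ zero)  q) (*<* (ℤ.+<+ ()))
  ¬forbidden⇒recurrent ¬f T (mkℚᵘ ℤ.-[1+ p ]  q) (*<* ())
  ¬forbidden⇒recurrent ¬f T (mkℚᵘ (ℤ.+ suc p) q) δ>0 =
    N , Equivalence.from (Pr-visits⇔ (suc p) q T N) (begin
      misses c T N c * suc q        ≤⟨ *-monoˡ-≤ (suc q) misses≤ ⟩
      K ^ T * B ^ r * suc q         ≡⟨ *-assoc (K ^ T) (B ^ r) (suc q) ⟩
      K ^ T * (B ^ r * suc q)       ≤⟨ *-monoʳ-≤ (K ^ T) (proj₂ (power-dominates B (suc q))) ⟩
      K ^ T * suc B ^ r             ≡⟨ cong (λ x → K ^ T * x ^ r) suc-B ⟩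
      K ^ T * (K ^ L) ^ r           ≡⟨ cong (K ^ T *_) (^-*-assoc K L r) ⟩
      K ^ T * K ^ (L * r)           ≡⟨ cong (λ x → K ^ T * K ^ x) (*-comm L r) ⟩
      K ^ T * K ^ N                 ≡⟨ ^-distribˡ-+-* K T N ⟨
      -- `δ` is at least `1 / (q + 1)`, the precision reached so far.
      K ^ (T + N)                   ≤⟨ m≤n*m (K ^ (T + N)) (suc p) ⟩
      suc p * K ^ (T + N)           ∎)
    where
    open ≤-Reasoning
    above : ∃[ d ] (d ⟶* c × (∀ s → Stable s → s ≤ᶜ d))
    above = above-stable c stable ¬f
    d : Config m n
    d = proj₁ above
    L B r N : ℕ
    -- One fixed first draw, then at most `size d` steps to `c` from any stable state.
    L = suc (size d)
    B = pred (K ^ L)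
    r = proj₁ (power-dominates B (suc q))
    N = r * L
    suc-B : suc B ≡ K ^ L
    suc-B = suc-pred (K ^ L) {{>-nonZero (m+n^>0 c L)}}
    reachable : ∀ s → Stable s → s ⇝[ size d ] c
    reachable s sStable = subst₂ (λ s c → s ⇝[ size d ] c)
      (stabilise-unique ε sStable) (stabilise-unique (proj₁ (proj₂ above)) stable)
      (stabilise-reachable s d (size d) (proj₂ (proj₂ above) s sStable) (m≤m+n (size d) (size s)))
    -- The first draw is a bottom vertex, since `m` may be 0.
    v : Vertex m n
    v = inj₂ (Fin.fromℕ< (>-nonZero⁻¹ n))
    block≤B : ∀ s → Stable s → misses c 0 L s ≤ B
    block≤B s _ = s≤s⁻¹ (subst (misses c 0 L s <_) (sym suc-B)
      (misses-reachable c (size d) s v (reachable (step s v) (stabilise-stable (addGrain v s)))))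
    misses≤ : misses c T N c ≤ K ^ T * B ^ r
    misses≤ = misses-burn-in c T N (B ^ r) (misses-blocks c L B block≤B r) c stable

theorem4p1 : ∀ (m n : ℕ) .{{_ : NonZero n}} (cᵗ : Vec ℕ m) (cᵇ : Vec ℕ n) →
    Stable (cᵗ , cᵇ) →
    ∀ (c̃ᵇ : Vector ℕ n) → IsNonDecreasingRearrangement c̃ᵇ cᵇ →
    DeterministicallyRecurrent (cᵗ , cᵇ) ⇔ (∀ (j : Fin n) → c̃ᵇ j ≥ k cᵗ j)
theorem4p1 m n cᵗ cᵇ stable c̃ᵇ sorted = mk⇔
  (Equivalence.to (¬forbidden⇔ cᵗ cᵇ c̃ᵇ sorted) ∘ recurrent⇒¬forbidden (cᵗ , cᵇ) stable)
  (¬forbidden⇒recurrent (cᵗ , cᵇ) stable ∘ Equivalence.from (¬forbidden⇔ cᵗ cᵇ c̃ᵇ sorted))
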